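{- Let $\tau$ be a plural algebraic type containing constant symbols and let $\mathcal{V}$ be a strongly irregular variety of type $\tau$. Then the lattice of subvarieties of its regularization satisfies $\mathbf{L}(R(\mathcal{V}))\cong \mathbf{L}(\mathcal{V})\times\mathbf{2}$ (isomorphism of lattices).
   Context: A type is plural if it contains at least one operation symbol of arity at least $2$. An identity $\varphi\approx\psi$ is regular if $Var(\varphi)=Var(\psi)$, i.e. the same variables occur on both sides. A variety $\mathcal{V}$ is strongly irregular if there is a binary term $f(x,y)$, in which both $x$ and $y$ actually occur, such that $\mathcal{V}\models f(x,y)\approx x$. The regularization $R(\mathcal{V})$ is the variety (of the same type) defined by all regular identities holding in $\mathcal{V}$. $\mathbf{L}(\mathcal{V})$ is the lattice of subvarieties of $\mathcal{V}$ ordered by inclusion, and $\mathbf{2}$ is the two-element chain. -}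

module Defs where

open import Algebra.Lattice.Bundles using (Lattice)
open import Algebra.Lattice.Morphism.Structures using (IsLatticeIsomorphism)
open import Data.Bool.Properties using (∨-∧-lattice)
open import Data.Fin.Base using (Fin)
open import Data.Fin.Patterns using (0F; 1F)
open import Data.Nat.Base using (ℕ; _≤_)
open import Data.Product.Base using (_×_; _,_; proj₁; proj₂; ∃; ∃-syntax; Σ-syntax; swap; zip)
open import Data.Product.Relation.Binary.Pointwise.NonDependent using (Pointwise; ×-isEquivalence)
open import Data.Sum.Base using (_⊎_; inj₁; inj₂; [_,_])
open import Data.Vec.Functional using (Vector)
open import Function.Base using (id; _∘_)
open import Function.Bundles using (_⇔_; mk⇔; module Equivalence)
open import Level as Level using (Level; suc; 0ℓ)
open import Relation.Binary.Bundles using (Setoid)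
open import Relation.Binary.Core using (Rel)
import Relation.Binary.Lattice as Ord
import Relation.Binary.Lattice.Properties.Lattice as LatticeProperties
open import Relation.Binary.PropositionalEquality.Core using (_≡_)
open import Relation.Unary using (Pred; _∈_; _⊆_; _≐_; _∩_; ｛_｝; ⋃)

open Equivalence using (to; from)

record Signature (ℓ : Level) : Set (suc ℓ) where
  field
    Op : Set ℓ
    ar : Op → ℕ

Plural : ∀ {ℓ} → Signature ℓ → Set ℓ
Plural τ = ∃[ o ] 2 ≤ ar o
  where open Signature τ

HasConstant : ∀ {ℓ} → Signature ℓ → Set ℓ
HasConstant τ = ∃[ c ] ar c ≡ 0
  where open Signature τ

module UniversalAlgebra {ℓ : Level} (τ : Signature ℓ) where
  open Signature τ

  data Term (X : Set) : Set ℓ where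
    var : X → Term X
    op  : (o : Op) → Vector (Term X) (ar o) → Term X

  Var : {X : Set} → Term X → Pred X 0ℓ
  Var (var x)   = ｛ x ｝
  Var (op o ts) = ⋃ (Fin (ar o)) λ i → Var (ts i)

  -- Algebras live on setoids, so that quotient algebras are algebras.
  record Algebra : Set (suc ℓ) where
    field
      setoid : Setoid ℓ ℓ
    open Setoid setoid public
    field
      ⟦_⟧     : (o : Op) → Vector Carrier (ar o) → Carrier
      ⟦⟧-cong : (o : Op) {as bs : Vector Carrier (ar o)} →
                (∀ i → as i ≈ bs i) → ⟦ o ⟧ as ≈ ⟦ o ⟧ bs

    eval : {X : Set} → (X → Carrier) → Term X → Carrier
    eval ρ (var x)   = ρ x
    eval ρ (op o ts) = ⟦ o ⟧ λ i → eval ρ (ts i)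

  infixr 6 _⊔_
  infixr 7 _⊓_
  infix 4 _⊨_≈_ _⊨ₑ_ _⊫_≈_ _⊑_

  _⊨_≈_ : Algebra → {X : Set} → Term X → Term X → Set ℓ
  A ⊨ s ≈ t = ∀ ρ → Algebra._≈_ A (Algebra.eval A ρ s) (Algebra.eval A ρ t)

  Equations : Set (suc (suc ℓ))
  Equations = Rel (Term ℕ) (suc ℓ)

  _⊨ₑ_ : Algebra → Equations → Set (suc ℓ)
  A ⊨ₑ E = ∀ s t → E s t → A ⊨ s ≈ t

  record Variety : Set (suc (suc ℓ)) where
    field
      Member       : Pred Algebra (suc ℓ)
      isEquational : Σ[ E ∈ Equations ] (∀ A → A ∈ Member ⇔ A ⊨ₑ E)

  open Variety public using (Member)

  _⊫_≈_ : Variety → {X : Set} → Term X → Term X → Set (suc ℓ)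
  V ⊫ s ≈ t = ∀ A → A ∈ Member V → A ⊨ s ≈ t

  Mod : Equations → Variety
  Mod E = record { Member = _⊨ₑ E ; isEquational = E , λ _ → mk⇔ id id }

  Regular : {X : Set} → Term X → Term X → Set
  Regular s t = Var s ≐ Var t

  StronglyIrregular : Variety → Set (suc ℓ)
  StronglyIrregular V =
    Σ[ f ∈ Term (Fin 2) ] 0F ∈ Var f × 1F ∈ Var f × V ⊫ f ≈ var 0F

  R : Variety → Variety
  R V = Mod λ s t → Regular s t × V ⊫ s ≈ t

  _⊑_ : Rel Variety (suc ℓ)
  V ⊑ W = Member V ⊆ Member W

  _⊓_ : Variety → Variety → Variety
  V ⊓ W = record
    { Member       = Member V ∩ Member W
    ; isEquational = (λ s t → E s t ⊎ F s t) , λ A → mk⇔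
        (λ (v , w) s t → [ to (V⇔ A) v s t , to (W⇔ A) w s t ])
        (λ m → from (V⇔ A) (λ s t → m s t ∘ inj₁) , from (W⇔ A) (λ s t → m s t ∘ inj₂))
    }
    where
    open Variety V using () renaming (isEquational to V-eq)
    open Variety W using () renaming (isEquational to W-eq)
    E = proj₁ V-eq
    F = proj₁ W-eq
    V⇔ = proj₂ V-eq
    W⇔ = proj₂ W-eq

  _⊔_ : Variety → Variety → Variety
  V ⊔ W = Mod λ s t → V ⊫ s ≈ t × W ⊫ s ≈ t

  ⊔-upperˡ : ∀ V W → V ⊑ V ⊔ W
  ⊔-upperˡ V W {A} a s t e = proj₁ e A a

  ⊔-upperʳ : ∀ V W → W ⊑ V ⊔ W
  ⊔-upperʳ V W {A} a s t e = proj₂ e A a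

  ⊔-least : ∀ V W U → V ⊑ U → W ⊑ U → V ⊔ W ⊑ U
  ⊔-least V W U V⊑U W⊑U {A} a = from (U⇔ A) λ s t e →
    a s t ( (λ B b → to (U⇔ B) (V⊑U b) s t e)
          , (λ B b → to (U⇔ B) (W⊑U b) s t e) )
    where U⇔ = proj₂ (Variety.isEquational U)

  Subvariety : Variety → Set (suc (suc ℓ))
  Subvariety V = Σ[ W ∈ Variety ] W ⊑ V

  subvarietyLattice : Variety → Ord.Lattice (suc (suc ℓ)) (suc ℓ) (suc ℓ)
  subvarietyLattice V = record
    { Carrier   = Subvariety V
    ; _≈_       = λ (W , _) (W′ , _) → Member W ≐ Member W′
    ; _≤_       = λ (W , _) (W′ , _) → W ⊑ W′
    ; _∨_       = λ (W , W⊑V) (W′ , W′⊑V) → W ⊔ W′ , λ {A} → ⊔-least W W′ V W⊑V W′⊑V {A}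
    ; _∧_       = λ (W , W⊑V) (W′ , _) → W ⊓ W′ , λ (w , _) → W⊑V w
    ; isLattice = record
      { isPartialOrder = record
        { isPreorder = record
          { isEquivalence = record
            { refl  = id , id
            ; sym   = swap
            ; trans = λ (p , q) (p′ , q′) → (λ a → p′ (p a)) , (λ a → q (q′ a))
            }
          ; reflexive = proj₁
          ; trans     = λ p q a → q (p a)
          }
        ; antisym = _,_
        }
      ; supremum = λ (W , _) (W′ , _) →
          (λ {A} → ⊔-upperˡ W W′ {A}) , (λ {A} → ⊔-upperʳ W W′ {A}) ,
          λ (U , _) p q {A} → ⊔-least W W′ U p q {A}
      ; infimum = λ _ _ → proj₁ , proj₂ , λ _ p q a → p a , q a
      }
    }

  L : Variety → Lattice (suc (suc ℓ)) (suc ℓ)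
  L V = LatticeProperties.algLattice (subvarietyLattice V)

infixr 5 _×ₗ_
infix 4 _≅_

_×ₗ_ : ∀ {a b ℓ₁ ℓ₂} → Lattice a ℓ₁ → Lattice b ℓ₂ → Lattice (a Level.⊔ b) (ℓ₁ Level.⊔ ℓ₂)
K ×ₗ M = record
  { Carrier   = K.Carrier × M.Carrier
  ; _≈_       = Pointwise K._≈_ M._≈_
  ; _∨_       = zip K._∨_ M._∨_
  ; _∧_       = zip K._∧_ M._∧_
  ; isLattice = record
    { isEquivalence = ×-isEquivalence K.isEquivalence M.isEquivalence
    ; ∨-comm     = λ (a , b) (c , d) → K.∨-comm a c , M.∨-comm b d
    ; ∨-assoc    = λ (a , b) (c , d) (e , f) → K.∨-assoc a c e , M.∨-assoc b d f
    ; ∨-cong     = zip K.∨-cong M.∨-cong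
    ; ∧-comm     = λ (a , b) (c , d) → K.∧-comm a c , M.∧-comm b d
    ; ∧-assoc    = λ (a , b) (c , d) (e , f) → K.∧-assoc a c e , M.∧-assoc b d f
    ; ∧-cong     = zip K.∧-cong M.∧-cong
    ; absorptive = (λ (a , b) (c , d) → K.∨-absorbs-∧ a c , M.∨-absorbs-∧ b d)
                 , (λ (a , b) (c , d) → K.∧-absorbs-∨ a c , M.∧-absorbs-∨ b d)
    }
  }
  where
  module K = Lattice K
  module M = Lattice M

𝟐 : Lattice 0ℓ 0ℓ
𝟐 = ∨-∧-lattice

_≅_ : ∀ {a b ℓ₁ ℓ₂} → Lattice a ℓ₁ → Lattice b ℓ₂ → Set (a Level.⊔ b Level.⊔ ℓ₁ Level.⊔ ℓ₂)
K ≅ M = ∃ (IsLatticeIsomorphism (Lattice.rawLattice K) (Lattice.rawLattice M))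

-- A subvariety W of R(V) is determined by W ⊓ V and by whether W contains the
-- two-element semilattice with unit 𝕊, that is, by whether all identities of W are
-- regular. If 𝕊 ∉ W, an irregular identity of W yields x ∙ y ≈ x with x ∙ y = f(x, y),
-- and then W ⊑ V because s ≈ s ∙ t ≈ t ∙ s ≈ t for every identity s ≈ t of V, the middle
-- identity being regular. If 𝕊 ∈ W, then W = R(W ⊓ V): a regular identity of W ⊓ V is
-- checked at a valuation in A ∈ W inside the Płonka fibre of A through the value w of one
-- side. In the presence of constants the fibre is not a subalgebra of A, but it is a
-- quotient of the subalgebra lying above it, hence still a member of W ⊓ V.
module Submission where

open import Defs
open import Algebra.Lattice.Bundles using (Lattice)
open import Axiom.ExcludedMiddle using (ExcludedMiddle)
open import Data.Bool.Base using (Bool; true; false; T)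
open import Data.Bool.Properties using (T?)
open import Data.Fin.Base using (Fin; toℕ) renaming (zero to fzero; suc to fsuc)
open import Data.Fin.Patterns using (0F; 1F; 2F)
open import Data.Fin.Properties using (all?; any?)
open import Data.Nat.Base using (ℕ; zero) renaming (suc to 1+_)
open import Data.Nat.Properties using (_≟_)
open import Data.Product.Base using (_×_; _,_; proj₁; proj₂; Σ-syntax; ∃-syntax)
open import Data.Sum.Base using (_⊎_; inj₁; inj₂; [_,_])
open import Data.Unit.Base using (tt)
open import Data.Vec.Functional using (Vector; []; _∷_)
open import Function.Base using (id; _∘_; const)
open import Function.Bundles using (_⇔_; mk⇔; module Equivalence)
open import Level using (Level; suc; Lift; lift; lower)
open import Relation.Binary.PropositionalEquality.Core using (_≡_; refl; cong; sym; trans; subst)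
open import Relation.Binary.PropositionalEquality.Properties using (setoid)
import Relation.Binary.Reasoning.Setoid as SetoidReasoning
open import Relation.Nullary.Decidable
  using (Dec; yes; no; does; map′; ¬?; decidable-stable; does-⇔; _×-dec_; _⊎-dec_)
open import Relation.Nullary.Negation using (¬_; contradiction)
open import Relation.Unary using (_∈_; _∉_; _⊆_)

open Equivalence using (to; from)

-- Indices beyond n repeat the last value.
extend : ∀ {a} {C : Set a} {n} → Vector C (1+ n) → ℕ → C
extend            ρ zero   = ρ fzero
extend {n = zero} ρ (1+ m) = ρ fzero
extend {n = 1+ n} ρ (1+ m) = extend (ρ ∘ fsuc) m

extend-toℕ : ∀ {a} {C : Set a} {n} (ρ : Vector C (1+ n)) i → extend ρ (toℕ i) ≡ ρ i
extend-toℕ            ρ fzero    = refl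
extend-toℕ {n = 1+ n} ρ (fsuc i) = extend-toℕ (ρ ∘ fsuc) i

does⁻ : ∀ {a} {P : Set a} (P? : Dec P) → T (does P?) → P
does⁻ (yes p) _ = p

does⁺ : ∀ {a} {P : Set a} (P? : Dec P) → P → T (does P?)
does⁺ (yes _) _ = tt
does⁺ (no ¬p) p = contradiction p ¬p

module _ {ℓ : Level} {τ : Signature ℓ} where
  open Signature τ
  open UniversalAlgebra τ

  private variable
    X Y : Set
    U W W′ : Variety

  -- Substitution, variables and evaluation of terms.

  sub : (X → Term Y) → Term X → Term Y
  sub σ (var x)   = σ x
  sub σ (op o ts) = op o λ i → sub σ (ts i)

  Var-sub⁺ : (σ : X → Term Y) (t : Term X) → ∀ {x} → x ∈ Var t → Var (σ x) ⊆ Var (sub σ t)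
  Var-sub⁺ σ (var x)   refl    y∈ = y∈
  Var-sub⁺ σ (op o ts) (i , p) y∈ = i , Var-sub⁺ σ (ts i) p y∈

  Var-sub⁻ : (σ : X → Term Y) (t : Term X) → ∀ {y} →
             y ∈ Var (sub σ t) → ∃[ x ] x ∈ Var t × y ∈ Var (σ x)
  Var-sub⁻ σ (var x)   y∈ = x , refl , y∈
  Var-sub⁻ σ (op o ts) (i , y∈) with Var-sub⁻ σ (ts i) y∈
  ... | x , x∈ , y∈σx = x , (i , x∈) , y∈σx

  sub-regular : (σ : X → Term Y) (s t : Term X) → Regular s t → Regular (sub σ s) (sub σ t)
  sub-regular σ s t (s⊆t , t⊆s) = mono s t s⊆t , mono t s t⊆s
    where
    mono : ∀ s t → Var s ⊆ Var t → Var (sub σ s) ⊆ Var (sub σ t)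
    mono s t s⊆t y∈ with Var-sub⁻ σ s y∈
    ... | x , x∈ , y∈σx = Var-sub⁺ σ t (s⊆t x∈) y∈σx

  infix 4 _∈Var?_

  _∈Var?_ : (x : ℕ) (t : Term ℕ) → Dec (x ∈ Var t)
  x ∈Var? var y   = y ≟ x
  x ∈Var? op o ts = any? λ i → x ∈Var? ts i

  module _ (A : Algebra) where
    open Algebra A renaming (refl to ≈-refl; sym to ≈-sym; trans to ≈-trans)

    eval-cong-Var : (t : Term X) {ρ ρ′ : X → Carrier} →
                    (∀ {x} → x ∈ Var t → ρ x ≈ ρ′ x) → eval ρ t ≈ eval ρ′ t
    eval-cong-Var (var x)   ρ≈ρ′ = ρ≈ρ′ refl
    eval-cong-Var (op o ts) ρ≈ρ′ = ⟦⟧-cong o λ i → eval-cong-Var (ts i) λ x∈ → ρ≈ρ′ (i , x∈)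

    eval-cong : (t : Term X) {ρ ρ′ : X → Carrier} → (∀ x → ρ x ≈ ρ′ x) → eval ρ t ≈ eval ρ′ t
    eval-cong t ρ≈ρ′ = eval-cong-Var t λ {x} _ → ρ≈ρ′ x

    eval-sub : (σ : X → Term Y) (ρ : Y → Carrier) (t : Term X) →
               eval ρ (sub σ t) ≈ eval (eval ρ ∘ σ) t
    eval-sub σ ρ (var x)   = ≈-refl
    eval-sub σ ρ (op o ts) = ⟦⟧-cong o λ i → eval-sub σ ρ (ts i)

    ⊨-sub : (σ : X → Term Y) (s t : Term X) → A ⊨ s ≈ t → A ⊨ sub σ s ≈ sub σ t
    ⊨-sub σ s t s≈t ρ = ≈-trans (eval-sub σ ρ s) (≈-trans (s≈t _) (≈-sym (eval-sub σ ρ t)))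

  ⊫-sub : ∀ V (σ : X → Term Y) (s t : Term X) → V ⊫ s ≈ t → V ⊫ sub σ s ≈ sub σ t
  ⊫-sub V σ s t s≈t A A∈V = ⊨-sub A σ s t (s≈t A A∈V)

  ⊫-sym : ∀ V (s t : Term X) → V ⊫ s ≈ t → V ⊫ t ≈ s
  ⊫-sym V s t s≈t A A∈V ρ = Algebra.sym A (s≈t A A∈V ρ)

  ⊫-trans : ∀ V (s t u : Term X) → V ⊫ s ≈ t → V ⊫ t ≈ u → V ⊫ s ≈ u
  ⊫-trans V s t u s≈t t≈u A A∈V ρ = Algebra.trans A (s≈t A A∈V ρ) (t≈u A A∈V ρ)

  -- Defining identities of varieties and the regularization.

  axioms : Variety → Equations
  axioms W = proj₁ (Variety.isEquational W)

  ∈⇒⊨ₑ : ∀ W A → A ∈ Member W → A ⊨ₑ axioms W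
  ∈⇒⊨ₑ W A = to (proj₂ (Variety.isEquational W) A)

  ⊨ₑ⇒∈ : ∀ W A → A ⊨ₑ axioms W → A ∈ Member W
  ⊨ₑ⇒∈ W A = from (proj₂ (Variety.isEquational W) A)

  axioms-⊫ : ∀ W {s t} → axioms W s t → W ⊫ s ≈ t
  axioms-⊫ W e A A∈W = ∈⇒⊨ₑ W A A∈W _ _ e

  ⊑R : ∀ V → V ⊑ R V
  ⊑R V {A} A∈V s t (_ , s≈t) = s≈t A A∈V

  R-mono : ∀ U V → U ⊑ V → R U ⊑ R V
  R-mono U V U⊑V A∈RU s t (r , s≈t) = A∈RU s t (r , λ B B∈U → s≈t B (U⊑V B∈U))

  -- The identities defining `R V` have variables in `ℕ`, so those over `Fin (1+ n)` are renamed
  -- along `toℕ`; nonemptiness of `Fin (1+ n)` supplies values for the remaining variables.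
  R-⊨ : ∀ V A → A ∈ Member (R V) → ∀ {n} (s t : Term (Fin (1+ n))) →
        Regular s t → V ⊫ s ≈ t → A ⊨ s ≈ t
  R-⊨ V A A∈RV s t r s≈t ρ =
    ≈-trans (≈-sym (eval-extend s)) (≈-trans
      (A∈RV (rename s) (rename t) (sub-regular _ s t r , ⊫-sub V _ s t s≈t) (extend ρ))
      (eval-extend t))
    where
    open Algebra A renaming (refl to ≈-refl; sym to ≈-sym; trans to ≈-trans)
    rename : Term (Fin (1+ _)) → Term ℕ
    rename = sub (var ∘ toℕ)
    eval-extend : ∀ u → eval (extend ρ) (rename u) ≈ eval ρ u
    eval-extend u = ≈-trans (eval-sub A _ _ u) (eval-cong A u λ i → reflexive (extend-toℕ ρ i))

  -- The two-element semilattice with unit and regular identities.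

  𝕊 : Algebra
  𝕊 = record
    { setoid  = setoid (Lift ℓ Bool)
    -- The conjunction of all arguments; a constant, as the empty conjunction, is the unit `true`.
    ; ⟦_⟧     = λ o as → lift (does (all? λ i → T? (lower (as i))))
    ; ⟦⟧-cong = λ o as≡bs → cong lift (does-⇔
        (mk⇔ (λ p i → subst (T ∘ lower) (as≡bs i) (p i)) (λ p i → subst (T ∘ lower) (sym (as≡bs i)) (p i)))
        (all? _) (all? _))
    }

  T-eval-𝕊⁻ : (ρ : X → Lift ℓ Bool) (t : Term X) →
              T (lower (Algebra.eval 𝕊 ρ t)) → ∀ {x} → x ∈ Var t → T (lower (ρ x))
  T-eval-𝕊⁻ ρ (var x)   p refl     = p
  T-eval-𝕊⁻ ρ (op o ts) p (i , x∈) = T-eval-𝕊⁻ ρ (ts i) (does⁻ (all? _) p i) x∈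

  T-eval-𝕊⁺ : (ρ : X → Lift ℓ Bool) (t : Term X) →
              (∀ {x} → x ∈ Var t → T (lower (ρ x))) → T (lower (Algebra.eval 𝕊 ρ t))
  T-eval-𝕊⁺ ρ (var x)   p = p refl
  T-eval-𝕊⁺ ρ (op o ts) p = does⁺ (all? _) λ i → T-eval-𝕊⁺ ρ (ts i) λ x∈ → p (i , x∈)

  -- A term denotes in `𝕊` the conjunction of its variables, so only its set of variables matters.
  regular⇒𝕊⊨ : (s t : Term X) → Regular s t → 𝕊 ⊨ s ≈ t
  regular⇒𝕊⊨ s t (s⊆t , t⊆s) ρ = cong lift (does-⇔
    (mk⇔ (λ p → T-eval-𝕊⁺ ρ t λ x∈ → T-eval-𝕊⁻ ρ s p (t⊆s x∈))
         (λ p → T-eval-𝕊⁺ ρ s λ x∈ → T-eval-𝕊⁻ ρ t p (s⊆t x∈)))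
    (T? _) (T? _))

  -- If `x` were missing from `t`, the valuation that is false at `x` only would make `t` true and
  -- `s` false.
  𝕊⊨⇒Var⊆ : (s t : Term ℕ) → 𝕊 ⊨ s ≈ t → Var s ⊆ Var t
  𝕊⊨⇒Var⊆ s t s≈t {x} x∈s = decidable-stable (x ∈Var? t) λ x∉t →
    does⁻ (¬? (x ≟ x)) (T-eval-𝕊⁻ ρ s
      (subst (T ∘ lower) (sym (s≈t ρ)) (T-eval-𝕊⁺ ρ t λ {y} y∈t →
        does⁺ (¬? (x ≟ y)) λ { refl → x∉t y∈t })) x∈s) refl
    where
    ρ : ℕ → Lift ℓ Bool
    ρ y = lift (does (¬? (x ≟ y)))

  𝕊⊨⇒regular : (s t : Term ℕ) → 𝕊 ⊨ s ≈ t → Regular s t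
  𝕊⊨⇒regular s t s≈t = 𝕊⊨⇒Var⊆ s t s≈t , 𝕊⊨⇒Var⊆ t s λ ρ → sym (s≈t ρ)

  𝕊∈R : ∀ V → 𝕊 ∈ Member (R V)
  𝕊∈R V s t (r , _) = regular⇒𝕊⊨ s t r

  -- The binary term witnessing strong irregularity.

  module StrongIrregularity (V : Variety) (f : Term (Fin 2))
    (0∈f : 0F ∈ Var f) (1∈f : 1F ∈ Var f) (f≈0 : V ⊫ f ≈ var 0F) where

    infixl 7 _∙_

    -- The left projection in `V`; in algebras of `R V` it is the partition operation of the Płonka
    -- decomposition.
    _∙_ : Term X → Term X → Term X
    s ∙ t = sub (s ∷ t ∷ []) f

    ∙-Varˡ : (s t : Term X) → Var s ⊆ Var (s ∙ t)
    ∙-Varˡ s t = Var-sub⁺ _ f 0∈f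

    ∙-Varʳ : (s t : Term X) → Var t ⊆ Var (s ∙ t)
    ∙-Varʳ s t = Var-sub⁺ _ f 1∈f

    ∙-Var⊆ : ∀ {P : X → Set} (s t : Term X) → Var s ⊆ P → Var t ⊆ P → Var (s ∙ t) ⊆ P
    ∙-Var⊆ s t s⊆P t⊆P x∈ with Var-sub⁻ (s ∷ t ∷ []) f x∈
    ... | 0F , _ , x∈s = s⊆P x∈s
    ... | 1F , _ , x∈t = t⊆P x∈t

    ∙-comm-regular : (s t : Term X) → Regular (s ∙ t) (t ∙ s)
    ∙-comm-regular s t = ∙-Var⊆ s t (∙-Varʳ t s) (∙-Varˡ t s)
                       , ∙-Var⊆ t s (∙-Varʳ s t) (∙-Varˡ s t)

    ∙-absorb-regular : (s t : Term X) → Var t ⊆ Var s → Regular (s ∙ t) s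
    ∙-absorb-regular s t t⊆s = ∙-Var⊆ s t id t⊆s , ∙-Varˡ s t

    ∙-absorb : U ⊑ V → (s t : Term X) → U ⊫ s ∙ t ≈ s
    ∙-absorb U⊑V s t A A∈U = ⊫-sub V (s ∷ t ∷ []) f (var 0F) f≈0 A (U⊑V A∈U)

    ∙-absorb-V : (s t : Term X) → V ⊫ s ∙ t ≈ s
    ∙-absorb-V = ∙-absorb {U = V} id

    -- A source of laws of `R V`: both sides collapse to `s` in `V`, so only their variable sets
    -- remain to be compared.
    ∙-absorb₂ : (s t u : Term X) → V ⊫ s ∙ t ≈ s ∙ u
    ∙-absorb₂ s t u = ⊫-trans V (s ∙ t) s (s ∙ u) (∙-absorb-V s t) (⊫-sym V (s ∙ u) s (∙-absorb-V s u))

    ∙-comm : U ⊑ V → (s t : Term X) → U ⊫ s ≈ t → U ⊫ s ∙ t ≈ t ∙ s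
    ∙-comm {U} U⊑V s t s≈t = ⊫-trans U (s ∙ t) s (t ∙ s) (∙-absorb {U = U} U⊑V s t)
      (⊫-trans U s t (t ∙ s) s≈t (⊫-sym U (t ∙ s) t (∙-absorb {U = U} U⊑V t s)))

    -- With the first variable true and the second false, `f` is false because its second variable
    -- occurs, while the projection is true.
    𝕊∉V : 𝕊 ∉ Member V
    𝕊∉V 𝕊∈V = T-eval-𝕊⁻ ρ f (subst (T ∘ lower) (sym (f≈0 𝕊 𝕊∈V ρ)) tt) 1∈f
      where
      ρ : Fin 2 → Lift ℓ Bool
      ρ = lift true ∷ lift false ∷ []

    -- The operation induced by `f` on an algebra, and Płonka fibres.

    module Multiplication (A : Algebra) where
      open Algebra A renaming (refl to ≈-refl; sym to ≈-sym; trans to ≈-trans)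

      infixl 7 _·_

      _·_ : Carrier → Carrier → Carrier
      a · b = eval (a ∷ b ∷ []) f

      ·-cong : ∀ {a a′ b b′} → a ≈ a′ → b ≈ b′ → a · b ≈ a′ · b′
      ·-cong a≈a′ b≈b′ = eval-cong A f λ { 0F → a≈a′ ; 1F → b≈b′ }

      eval-∙ : (ρ : X → Carrier) (s t : Term X) → eval ρ (s ∙ t) ≈ eval ρ s · eval ρ t
      eval-∙ ρ s t = ≈-trans (eval-sub A _ ρ f) (eval-cong A f λ { 0F → ≈-refl ; 1F → ≈-refl })

    -- If U ⊫ s ≈ t then s ∙ t ≈ t ∙ s is a regular identity of U.
    absorbing⇒∈ : ∀ A → U ⊑ V → A ∈ Member (R U) → A ⊨ f ≈ var 0F → A ∈ Member U
    absorbing⇒∈ {U} A U⊑V A∈RU f≈x = ⊨ₑ⇒∈ U A λ s t e ρ → begin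
      eval ρ s       ≈⟨ absorb ρ s t ⟨
      eval ρ (s ∙ t) ≈⟨ A∈RU (s ∙ t) (t ∙ s) (∙-comm-regular s t , ∙-comm {U = U} U⊑V s t (axioms-⊫ U e)) ρ ⟩
      eval ρ (t ∙ s) ≈⟨ absorb ρ t s ⟩
      eval ρ t       ∎
      where
      open Algebra A using (eval; _≈_)
      open SetoidReasoning (Algebra.setoid A)
      absorb : ∀ ρ (s t : Term ℕ) → eval ρ (s ∙ t) ≈ eval ρ s
      absorb ρ s t = ⊨-sub A (s ∷ t ∷ []) f (var 0F) f≈x ρ

    ∈V∩R⇒∈ : U ⊑ V → ∀ {A} → A ∈ Member V → A ∈ Member (R U) → A ∈ Member U
    ∈V∩R⇒∈ {U} U⊑V {A} A∈V A∈RU = absorbing⇒∈ {U} A U⊑V A∈RU (f≈0 A A∈V)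

    -- The fibre over w of the Płonka decomposition of A, realised as a quotient of a
    -- subalgebra: the elements of A above w in the semilattice of fibres, identified
    -- when they agree after being mapped down to the fibre of w.
    module Fibre (A : Algebra) (A∈RV : A ∈ Member (R V)) (w : Algebra.Carrier A) where
      open Algebra A renaming (refl to ≈-refl; sym to ≈-sym; trans to ≈-trans)
      open Multiplication A
      open SetoidReasoning (Algebra.setoid A)

      -- The term o(x, ..., x) has no variable besides x. For a constant this puts its value above
      -- every `w`, so that it lies in the carrier of the fibre.
      ·-op-absorb : (o : Op) → w · ⟦ o ⟧ (const w) ≈ w
      ·-op-absorb o = ≈-trans (≈-sym (eval-∙ (w ∷ []) x p))
        (R-⊨ V A A∈RV (x ∙ p) x (∙-absorb-regular x p proj₂) (∙-absorb-V x p) (w ∷ []))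
        where
        x p : Term (Fin 1)
        x = var 0F
        p = op o λ _ → x

      -- Both sides collapse to `w` in `V`. Each factor `w · as i` becomes `w` once the arguments
      -- lie above `w`, which gives closure of the fibre.
      ·-op-expand : (o : Op) (as : Vector Carrier (ar o)) → w · ⟦ o ⟧ as ≈ w · ⟦ o ⟧ λ i → w · as i
      ·-op-expand o as = begin
        w · ⟦ o ⟧ as               ≈⟨ eval-∙ ρ x p ⟨
        eval ρ (x ∙ p)             ≈⟨ R-⊨ V A A∈RV (x ∙ p) (x ∙ q) regular (∙-absorb₂ x p q) ρ ⟩
        eval ρ (x ∙ q)             ≈⟨ eval-∙ ρ x q ⟩
        w · eval ρ q               ≈⟨ ·-cong ≈-refl (⟦⟧-cong o λ i → eval-∙ ρ x (var (fsuc i))) ⟩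
        w · ⟦ o ⟧ (λ i → w · as i) ∎
        where
        ρ = w ∷ as
        x = var 0F
        p = op o λ i → var (fsuc i)
        q = op o λ i → x ∙ var (fsuc i)
        regular : Regular (x ∙ p) (x ∙ q)
        regular =
            ∙-Var⊆ x p (∙-Varˡ x q) (λ (i , y∈) → ∙-Varʳ x q (i , ∙-Varʳ x (var (fsuc i)) y∈))
          , ∙-Var⊆ x q (∙-Varˡ x p) (λ (i , y∈) →
              ∙-Var⊆ x (var (fsuc i)) (∙-Varˡ x p) (λ z∈ → ∙-Varʳ x p (i , z∈)) y∈)

      -- Makes the map down to the fibre of `w` compatible with operations. The outer factor `w` on
      -- the right-hand side keeps the variable sets equal even when `o` is a constant.
      op-·-expand : (o : Op) (as : Vector Carrier (ar o)) → ⟦ o ⟧ as · w ≈ ⟦ o ⟧ (λ i → as i · w) · w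
      op-·-expand o as = begin
        ⟦ o ⟧ as · w               ≈⟨ eval-∙ ρ p x ⟨
        eval ρ (p ∙ x)             ≈⟨ R-⊨ V A A∈RV (p ∙ x) (q ∙ x) regular p∙x≈q∙x ρ ⟩
        eval ρ (q ∙ x)             ≈⟨ eval-∙ ρ q x ⟩
        eval ρ q · w               ≈⟨ ·-cong (⟦⟧-cong o λ i → eval-∙ ρ (var (fsuc i)) x) ≈-refl ⟩
        ⟦ o ⟧ (λ i → as i · w) · w ∎
        where
        ρ = w ∷ as
        x = var 0F
        p = op o λ i → var (fsuc i)
        q = op o λ i → var (fsuc i) ∙ x
        p≈q : V ⊫ p ≈ q
        p≈q B B∈V σ = Algebra.⟦⟧-cong B o λ i → Algebra.sym B (∙-absorb-V (var (fsuc i)) x B B∈V σ)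
        p∙x≈q∙x : V ⊫ p ∙ x ≈ q ∙ x
        p∙x≈q∙x = ⊫-trans V (p ∙ x) p (q ∙ x) (∙-absorb-V p x)
          (⊫-trans V p q (q ∙ x) p≈q (⊫-sym V (q ∙ x) q (∙-absorb-V q x)))
        regular : Regular (p ∙ x) (q ∙ x)
        regular =
            ∙-Var⊆ p x (λ (i , y∈) → ∙-Varˡ q x (i , ∙-Varˡ (var (fsuc i)) x y∈)) (∙-Varʳ q x)
          , ∙-Var⊆ q x (λ (i , y∈) →
              ∙-Var⊆ (var (fsuc i)) x (λ z∈ → ∙-Varˡ p x (i , z∈)) (∙-Varʳ p x) y∈) (∙-Varʳ p x)

      -- Isolates `w · b`, which is `w` for `b` in the fibre, so that `b` disappears.
      ·-rearrange : ∀ a b → a · b · w ≈ a · (w · b)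
      ·-rearrange a b = begin
        a · b · w            ≈⟨ ·-cong (eval-∙ ρ x y) ≈-refl ⟨
        eval ρ (x ∙ y) · w   ≈⟨ eval-∙ ρ (x ∙ y) z ⟨
        eval ρ (x ∙ y ∙ z)   ≈⟨ R-⊨ V A A∈RV (x ∙ y ∙ z) (x ∙ (z ∙ y)) regular xyz≈xzy ρ ⟩
        eval ρ (x ∙ (z ∙ y)) ≈⟨ eval-∙ ρ x (z ∙ y) ⟩
        a · eval ρ (z ∙ y)   ≈⟨ ·-cong ≈-refl (eval-∙ ρ z y) ⟩
        a · (w · b)          ∎
        where
        ρ = a ∷ b ∷ w ∷ []
        x y z : Term (Fin 3)
        x = var 0F
        y = var 1F
        z = var 2F
        xyz≈xzy : V ⊫ x ∙ y ∙ z ≈ x ∙ (z ∙ y)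
        xyz≈xzy = ⊫-trans V (x ∙ y ∙ z) (x ∙ y) (x ∙ (z ∙ y)) (∙-absorb-V (x ∙ y) z) (∙-absorb₂ x y (z ∙ y))
        regular : Regular (x ∙ y ∙ z) (x ∙ (z ∙ y))
        regular =
            ∙-Var⊆ (x ∙ y) z
              (∙-Var⊆ x y (∙-Varˡ x (z ∙ y)) (∙-Varʳ x (z ∙ y) ∘ ∙-Varʳ z y))
              (∙-Varʳ x (z ∙ y) ∘ ∙-Varˡ z y)
          , ∙-Var⊆ x (z ∙ y) (∙-Varˡ (x ∙ y) z ∘ ∙-Varˡ x y)
              (∙-Var⊆ z y (∙-Varʳ (x ∙ y) z) (∙-Varˡ (x ∙ y) z ∘ ∙-Varʳ x y))

      fibre : Algebra
      fibre = record
        { setoid = record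
          -- `w · a ≈ w` expresses that the fibre of `a` lies above that of `w`; `a · w` is the
          -- image of `a` in the fibre of `w`.
          { Carrier       = Σ[ a ∈ Carrier ] w · a ≈ w
          ; _≈_           = λ (a , _) (b , _) → a · w ≈ b · w
          ; isEquivalence = record { refl = ≈-refl ; sym = ≈-sym ; trans = ≈-trans }
          }
        ; ⟦_⟧ = λ o as → ⟦ o ⟧ (proj₁ ∘ as) , (begin
            w · ⟦ o ⟧ (proj₁ ∘ as)             ≈⟨ ·-op-expand o (proj₁ ∘ as) ⟩
            w · ⟦ o ⟧ (λ i → w · proj₁ (as i)) ≈⟨ ·-cong ≈-refl (⟦⟧-cong o (proj₂ ∘ as)) ⟩
            w · ⟦ o ⟧ (const w)                ≈⟨ ·-op-absorb o ⟩
            w                                  ∎)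
        ; ⟦⟧-cong = λ o {as} {bs} as≈bs → begin
            ⟦ o ⟧ (proj₁ ∘ as) · w             ≈⟨ op-·-expand o (proj₁ ∘ as) ⟩
            ⟦ o ⟧ (λ i → proj₁ (as i) · w) · w ≈⟨ ·-cong (⟦⟧-cong o as≈bs) ≈-refl ⟩
            ⟦ o ⟧ (λ i → proj₁ (bs i) · w) · w ≈⟨ op-·-expand o (proj₁ ∘ bs) ⟨
            ⟦ o ⟧ (proj₁ ∘ bs) · w             ∎
        }

      eval-fibre : (ρ : X → Algebra.Carrier fibre) (t : Term X) →
                   proj₁ (Algebra.eval fibre ρ t) ≈ eval (proj₁ ∘ ρ) t
      eval-fibre ρ (var x)   = ≈-refl
      eval-fibre ρ (op o ts) = ⟦⟧-cong o λ i → eval-fibre ρ (ts i)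

      ⊨-fibre : (s t : Term X) → A ⊨ s ≈ t → fibre ⊨ s ≈ t
      ⊨-fibre s t s≈t ρ =
        ·-cong (≈-trans (eval-fibre ρ s) (≈-trans (s≈t _) (≈-sym (eval-fibre ρ t)))) ≈-refl

      fibre∈ : ∀ W → A ∈ Member W → fibre ∈ Member W
      fibre∈ W A∈W = ⊨ₑ⇒∈ W fibre λ s t e → ⊨-fibre s t (∈⇒⊨ₑ W A A∈W s t e)

      fibre-absorbing : fibre ⊨ f ≈ var 0F
      fibre-absorbing ρ = begin
        proj₁ (Algebra.eval fibre ρ f) · w ≈⟨ ·-cong (eval-fibre ρ f) ≈-refl ⟩
        eval (proj₁ ∘ ρ) f · w             ≈⟨ ·-cong (eval-cong A f λ { 0F → ≈-refl ; 1F → ≈-refl }) ≈-refl ⟩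
        a · b · w                          ≈⟨ ·-rearrange a b ⟩
        a · (w · b)                        ≈⟨ ·-cong ≈-refl (proj₂ (ρ 1F)) ⟩
        a · w                              ∎
        where
        a = proj₁ (ρ 0F)
        b = proj₁ (ρ 1F)

      fibre∈V : fibre ∈ Member V
      fibre∈V = absorbing⇒∈ {V} fibre id (fibre∈ (R V) A∈RV) fibre-absorbing

    -- Regular and irregular identities in subvarieties of `R V`.

    regular-⊓ : W ⊑ R V → (s t : Term ℕ) → Regular s t → W ⊓ V ⊫ s ≈ t → W ⊫ s ≈ t
    regular-⊓ {W} W⊑RV s t (s⊆t , t⊆s) s≈t A A∈W ρ = begin
      -- Both values survive multiplication by `w`, since `t` contains all variables of `s`; hence
      -- equality in the fibre, which compares values after this multiplication, is equality in `A`.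
      eval ρ s                            ≈⟨ absorb s id ⟨
      eval ρ s · w                        ≈⟨ ·-cong (eval-ρ′ s id) ≈-refl ⟨
      proj₁ (Algebra.eval fibre ρ′ s) · w ≈⟨ s≈t fibre (fibre∈ W A∈W , fibre∈V) ρ′ ⟩
      proj₁ (Algebra.eval fibre ρ′ t) · w ≈⟨ ·-cong (eval-ρ′ t t⊆s) ≈-refl ⟩
      eval ρ t · w                        ≈⟨ absorb t s⊆t ⟩
      eval ρ t                            ∎
      where
      open Algebra A renaming (refl to ≈-refl; sym to ≈-sym; trans to ≈-trans)
      open Multiplication A
      open SetoidReasoning (Algebra.setoid A)
      w = eval ρ s
      open Fibre A (W⊑RV {A} A∈W) w

      ∙-absorb-⊨ : (u v : Term ℕ) → Var v ⊆ Var u → eval ρ u · eval ρ v ≈ eval ρ u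
      ∙-absorb-⊨ u v v⊆u = ≈-trans (≈-sym (eval-∙ ρ u v))
        (W⊑RV {A} A∈W (u ∙ v) u (∙-absorb-regular u v v⊆u , ∙-absorb-V u v) ρ)

      absorb : (u : Term ℕ) → Var s ⊆ Var u → eval ρ u · w ≈ eval ρ u
      absorb u = ∙-absorb-⊨ u s

      ρ′ : ℕ → Algebra.Carrier fibre
      ρ′ x with x ∈Var? s
      ... | yes x∈s = ρ x , ∙-absorb-⊨ s (var x) λ { refl → x∈s }
      -- An arbitrary element of the fibre: such an `x` occurs in neither `s` nor `t`.
      ... | no  _   = w , absorb s id

      ρ′≈ρ : ∀ {x} → x ∈ Var s → proj₁ (ρ′ x) ≈ ρ x
      ρ′≈ρ {x} x∈s with x ∈Var? s
      ... | yes _   = ≈-refl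
      ... | no  x∉s = contradiction x∈s x∉s

      eval-ρ′ : (u : Term ℕ) → Var u ⊆ Var s → proj₁ (Algebra.eval fibre ρ′ u) ≈ eval ρ u
      eval-ρ′ u u⊆s = ≈-trans (eval-fibre ρ′ u) (eval-cong-Var A u (ρ′≈ρ ∘ u⊆s))

    -- Substituting y for a variable of s that does not occur in t, and x for all
    -- others, turns x ∙ s ≈ x ∙ t into x ∙ y ≈ x.
    irregular⇒absorbing : ∀ A → A ∈ Member (R V) → (s t : Term ℕ) → A ⊨ s ≈ t →
                          ∀ {x} → x ∈ Var s → x ∉ Var t → A ⊨ f ≈ var 0F
    irregular⇒absorbing A A∈RV s t s≈t {x} x∈s x∉t ρ = begin
      eval ρ f                ≈⟨ eval-cong A f (λ { 0F → ≈-refl ; 1F → ≈-refl }) ⟩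
      ρ 0F · ρ 1F             ≈⟨ eval-∙ ρ u v ⟨
      -- Since `x` occurs in `s`, `v` occurs in `sub σ s`, and the variable sets agree.
      eval ρ (u ∙ v)          ≈⟨ R-⊨ V A A∈RV (u ∙ v) (u ∙ sub σ s) regular-s (∙-absorb₂ u v (sub σ s)) ρ ⟩
      eval ρ (u ∙ sub σ s)    ≈⟨ eval-∙ ρ u (sub σ s) ⟩
      ρ 0F · eval ρ (sub σ s) ≈⟨ ·-cong ≈-refl (⊨-sub A σ s t s≈t ρ) ⟩
      ρ 0F · eval ρ (sub σ t) ≈⟨ eval-∙ ρ u (sub σ t) ⟨
      eval ρ (u ∙ sub σ t)    ≈⟨ R-⊨ V A A∈RV (u ∙ sub σ t) u (∙-absorb-regular u (sub σ t) Var-t) (∙-absorb-V u (sub σ t)) ρ ⟩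
      ρ 0F                    ∎
      where
      open Algebra A renaming (refl to ≈-refl; sym to ≈-sym; trans to ≈-trans)
      open Multiplication A
      open SetoidReasoning (Algebra.setoid A)

      u v : Term (Fin 2)
      u = var 0F
      v = var 1F

      σ : ℕ → Term (Fin 2)
      σ y with x ≟ y
      ... | yes _ = var 1F
      ... | no  _ = var 0F

      1∈σx : 1F ∈ Var (σ x)
      1∈σx with x ≟ x
      ... | yes _   = refl
      ... | no  x≢x = contradiction refl x≢x

      Var-t : Var (sub σ t) ⊆ Var u
      Var-t z∈ with Var-sub⁻ σ t z∈
      ... | y , y∈t , z∈σy with x ≟ y
      ...   | yes refl = contradiction y∈t x∉t
      ...   | no  _    = z∈σy

      regular-s : Regular (u ∙ v) (u ∙ sub σ s)
      regular-s =
          ∙-Var⊆ u v (∙-Varˡ u (sub σ s))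
            (λ { refl → ∙-Varʳ u (sub σ s) (Var-sub⁺ σ s x∈s 1∈σx) })
        , λ { {0F} _ → ∙-Varˡ u v refl ; {1F} _ → ∙-Varʳ u v refl }

    -- A common identity `s ≈ t` of `W ⊓ V` and `W′ ⊓ V` yields the regular identity
    -- `s ∙ t ≈ t ∙ s`, which lifts to `W` and `W′` by `regular-⊓`, hence to their join, and
    -- collapses back to `s ≈ t` in `V`.
    ⊔-⊓-distribʳ : W ⊑ R V → W′ ⊑ R V → (W ⊔ W′) ⊓ V ⊑ (W ⊓ V) ⊔ (W′ ⊓ V)
    ⊔-⊓-distribʳ {W} {W′} W⊑RV W′⊑RV {A} (A∈W⊔W′ , A∈V) s t (e , e′) ρ = begin
      eval ρ s       ≈⟨ ∙-absorb-V s t A A∈V ρ ⟨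
      eval ρ (s ∙ t) ≈⟨ A∈W⊔W′ (s ∙ t) (t ∙ s) (comm W W⊑RV e , comm W′ W′⊑RV e′) ρ ⟩
      eval ρ (t ∙ s) ≈⟨ ∙-absorb-V t s A A∈V ρ ⟩
      eval ρ t       ∎
      where
      open Algebra A using (eval)
      open SetoidReasoning (Algebra.setoid A)
      comm : ∀ U → U ⊑ R V → U ⊓ V ⊫ s ≈ t → U ⊫ s ∙ t ≈ t ∙ s
      comm U U⊑RV e = regular-⊓ {W = U} U⊑RV (s ∙ t) (t ∙ s) (∙-comm-regular s t) (∙-comm {U = U ⊓ V} proj₂ s t e)

    -- Case distinction on membership of `𝕊`.

    module Classical (em : ExcludedMiddle (suc ℓ)) where

      stable : {P : Set ℓ} → ¬ ¬ P → P
      stable {P} = decidable-stable (map′ lower lift (em {Lift (suc ℓ) P}))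

      -- If some `A` in `W` failed `f ≈ var 0F`, all its identities would be regular by
      -- `irregular⇒absorbing`, so `𝕊` would satisfy the axioms of `W`.
      𝕊∉⇒⊑V : W ⊑ R V → 𝕊 ∉ Member W → W ⊑ V
      𝕊∉⇒⊑V {W} W⊑RV 𝕊∉W {A} A∈W = absorbing⇒∈ {V} A id (W⊑RV A∈W) λ ρ → stable λ ¬absorb →
        let
          Var⊆ : ∀ s t → A ⊨ s ≈ t → Var s ⊆ Var t
          Var⊆ s t s≈t {x} x∈s = decidable-stable (x ∈Var? t) λ x∉t →
            ¬absorb (irregular⇒absorbing A (W⊑RV A∈W) s t s≈t x∈s x∉t ρ)
        in
        𝕊∉W (⊨ₑ⇒∈ W 𝕊 λ s t e → let s≈t = ∈⇒⊨ₑ W A A∈W s t e in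
          regular⇒𝕊⊨ s t (Var⊆ s t s≈t , Var⊆ t s λ ρ′ → Algebra.sym A (s≈t ρ′)))

      -- If `𝕊` is in `W`, it is in `W′`, so the axioms of `W′` are regular and lift from `W ⊓ V` to
      -- `W`; otherwise `W` lies below `V` already.
      ⊓V-reflects-⊑ : W ⊑ R V → W ⊓ V ⊑ W′ ⊓ V → (𝕊 ∈ Member W → 𝕊 ∈ Member W′) → W ⊑ W′
      ⊓V-reflects-⊑ {W} {W′} W⊑RV W⊑W′ 𝕊⇒𝕊 {A} A∈W with em {𝕊 ∈ Member W}
      ... | yes 𝕊∈W = ⊨ₑ⇒∈ W′ A λ s t e →
        regular-⊓ {W = W} W⊑RV s t (𝕊⊨⇒regular s t (∈⇒⊨ₑ W′ 𝕊 (𝕊⇒𝕊 𝕊∈W) s t e))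
          (λ B B∈ → ∈⇒⊨ₑ W′ B (proj₁ (W⊑W′ B∈)) s t e) A A∈W
      ... | no  𝕊∉W = proj₁ (W⊑W′ (A∈W , 𝕊∉⇒⊑V {W} W⊑RV 𝕊∉W A∈W))

      hasSemilattice : Variety → Bool
      hasSemilattice W = does (em {𝕊 ∈ Member W})

      hasSemilattice-⇔ : ∀ {W} {P : Set (suc ℓ)} → 𝕊 ∈ Member W ⇔ P → (P? : Dec P) → hasSemilattice W ≡ does P?
      hasSemilattice-⇔ e P? = does-⇔ e em P?

      hasSemilattice-⇒ : hasSemilattice W ≡ hasSemilattice W′ → 𝕊 ∈ Member W → 𝕊 ∈ Member W′
      hasSemilattice-⇒ e 𝕊∈W = does⁻ em (subst T e (does⁺ em 𝕊∈W))

      -- The lattice isomorphism.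

      split : Subvariety (R V) → Subvariety V × Bool
      split (W , _) = (W ⊓ V , proj₂) , hasSemilattice W

      split-≅ : L (R V) ≅ L V ×ₗ 𝟐
      split-≅ = split , record
        { isLatticeMonomorphism = record
          { isLatticeHomomorphism = record
            { isRelHomomorphism = record { cong = λ {x} {y} → split-cong {x} {y} }
            ; ∧-homo = λ (W , _) (W′ , _) →
                ( (λ ((w , w′) , v) → (w , v) , w′ , v)
                , (λ ((w , v) , w′ , _) → (w , w′) , v))
              , hasSemilattice-⇔ {W ⊓ W′} (mk⇔ id id) (em {𝕊 ∈ Member W} ×-dec em {𝕊 ∈ Member W′})
            ; ∨-homo = λ (W , W⊑RV) (W′ , W′⊑RV) →
                ( (λ {A} → ⊔-⊓-distribʳ {W} {W′} W⊑RV W′⊑RV {A})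
                , (λ {A} → ⊔-least (W ⊓ V) (W′ ⊓ V) ((W ⊔ W′) ⊓ V)
                    (λ {B} (w , v) → ⊔-upperˡ W W′ {B} w , v)
                    (λ {B} (w′ , v) → ⊔-upperʳ W W′ {B} w′ , v) {A}))
              , hasSemilattice-⇔ {W ⊔ W′}
                  (mk⇔ (𝕊∈⊔ W W′ W⊑RV W′⊑RV) [ ⊔-upperˡ W W′ {𝕊} , ⊔-upperʳ W W′ {𝕊} ])
                  (em {𝕊 ∈ Member W} ⊎-dec em {𝕊 ∈ Member W′})
            }
          ; injective = λ { {W , W⊑RV} {W′ , W′⊑RV} ((p , q) , e) →
                ⊓V-reflects-⊑ {W} {W′} W⊑RV p (hasSemilattice-⇒ {W} {W′} e)
              , ⊓V-reflects-⊑ {W′} {W} W′⊑RV q (hasSemilattice-⇒ {W′} {W} (sym e)) }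
          }
        ; surjective = surj
        }
        where
        module K = Lattice (L (R V))
        module M = Lattice (L V ×ₗ 𝟐)

        split-cong : ∀ {x y} → x K.≈ y → split x M.≈ split y
        split-cong (p , q) = ((λ (w , v) → p w , v) , (λ (w , v) → q w , v)) , does-⇔ (mk⇔ p q) em em

        -- If both varieties omit `𝕊`, they lie below `V`, and so does their join; but `V` omits
        -- `𝕊`.
        𝕊∈⊔ : ∀ W W′ → W ⊑ R V → W′ ⊑ R V → 𝕊 ∈ Member (W ⊔ W′) → 𝕊 ∈ Member W ⊎ 𝕊 ∈ Member W′
        𝕊∈⊔ W W′ W⊑RV W′⊑RV 𝕊∈ with em {𝕊 ∈ Member W} | em {𝕊 ∈ Member W′}
        ... | yes 𝕊∈W | _ = inj₁ 𝕊∈W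
        ... | no _ | yes 𝕊∈W′ = inj₂ 𝕊∈W′
        ... | no 𝕊∉W | no 𝕊∉W′ =
          contradiction (⊔-least W W′ V (𝕊∉⇒⊑V {W} W⊑RV 𝕊∉W) (𝕊∉⇒⊑V {W′} W′⊑RV 𝕊∉W′) {𝕊} 𝕊∈) 𝕊∉V

        -- A subvariety `U` of `V` omits `𝕊` and serves for `false`; for `true`, `R U` adds `𝕊` to
        -- `U` but no further algebra of `V`.
        preimage : ∀ y → ∃[ x ] split x M.≈ y
        preimage ((U , U⊑V) , false) =
            (U , λ {A} A∈U → ⊑R V {A} (U⊑V A∈U))
          , (proj₁ , (λ u → u , U⊑V u))
          , hasSemilattice-⇔ {U} (mk⇔ id id) (no λ 𝕊∈U → 𝕊∉V (U⊑V 𝕊∈U))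
        preimage ((U , U⊑V) , true) =
            (R U , λ {A} → R-mono U V U⊑V {A})
          , ((λ (A∈RU , A∈V) → ∈V∩R⇒∈ {U} U⊑V A∈V A∈RU) , (λ {A} u → ⊑R U {A} u , U⊑V u))
          , hasSemilattice-⇔ {R U} (mk⇔ id id) (yes (𝕊∈R U))

        surj : ∀ y → ∃[ x ] (∀ {z} → z K.≈ x → split z M.≈ y)
        surj y with preimage y
        ... | x , x↦y = x , λ {z} z≈x → M.trans {split z} {split x} {y} (split-cong {z} {x} z≈x) x↦y

theorem5 : {ℓ : Level} → ExcludedMiddle (suc ℓ) →
    (τ : Signature ℓ) → Plural τ → HasConstant τ →
    let open UniversalAlgebra τ in
    (V : Variety) → StronglyIrregular V → L (R V) ≅ L V ×ₗ 𝟐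
theorem5 em τ _ _ V (f , 0∈f , 1∈f , f≈0) = split-≅
  where
  open StrongIrregularity V f 0∈f 1∈f f≈0
  open Classical em
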